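{- Let $A$ be a set, let $Q,R$ be predicates on $A$, and let $S$ be a binary relation on $A$. Let $wp(S,Q)$, $wp(S,R)$ and $wp(S,Q\land R)$ be the weakest preconditions of $S$ with respect to the postconditions $Q$, $R$ and $Q\land R$. Then $$\forall x\,\big(wp(S,Q)(x)\land wp(S,R)(x)\ \Leftrightarrow\ wp(S,Q\land R)(x)\big).$$
   Context: $A$ is an arbitrary set (the abstract state space); all quantified variables range over $A$. An $S$-predicate is a predicate $P:A\to\{\top,\bot\}$; an $S$-relation is an arbitrary binary relation $S\subseteq A\times A$, with $S(x,y)$ meaning $(x,y)\in S$ (neither totality nor determinism is assumed). Logical connectives applied to predicates are taken pointwise. The total correctness formula $\{P\}S\{Q\}$ abbreviates $$\forall x\,[P(x)\Rightarrow(\exists y\,S(x,y)\ \land\ \forall z\,(S(x,z)\Rightarrow Q(z)))].$$ The weakest precondition of $S$ with respect to a postcondition $Q$ is an $S$-predicate $wp(S,Q)$ such that: (WP1) $\{wp(S,Q)\}S\{Q\}$; and (WP2) for every $S$-predicate $P$, $\{P\}S\{Q\}\Rightarrow\forall x\,(P(x)\Rightarrow wp(S,Q)(x))$. The logic is classical first-order predicate logic. -}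

module Defs where

open import Level using (Level; suc)
open import Data.Product using (_×_; ∃-syntax)
open import Relation.Unary using (Pred)
open import Relation.Binary using (Rel)

-- Total correctness.  S need be neither total nor deterministic.
⟪_⟫_⟪_⟫ : ∀ {ℓ} {A : Set ℓ} → Pred A ℓ → Rel A ℓ → Pred A ℓ → Set ℓ
⟪ P ⟫ S ⟪ Q ⟫ = ∀ x → P x → (∃[ y ] S x y) × (∀ z → S x z → Q z)

-- W is a weakest precondition of S with respect to Q.  Propositions are
-- types in Set ℓ, the universe of the state space A, so that the condition
-- in a total correctness formula (which quantifies over A) is again a
-- predicate of the kind P ranges over; hence such a W always exists.
record IsWP {ℓ : Level} {A : Set ℓ}
            (S : Rel A ℓ) (Q W : Pred A ℓ) : Set (suc ℓ) where
  field
    wp₁ : ⟪ W ⟫ S ⟪ Q ⟫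
    wp₂ : ∀ (P : Pred A ℓ) → ⟪ P ⟫ S ⟪ Q ⟫ → ∀ x → P x → W x

{-# OPTIONS --safe #-}
module Submission where

open import Level using (Level)
open import Data.Product using (_×_; _,_; proj₁; proj₂; map₂; <_,_>)
open import Function.Bundles using (_⇔_; mk⇔)
open import Relation.Unary using (Pred; _∩_; _⊆_)
open import Relation.Binary using (Rel)
open import Defs

open IsWP

-- A weakest precondition is the largest predicate satisfying its total correctness formula. The
-- meet of the two preconditions secures both postconditions, so it lies below `wpQ∧R`; the converse
-- is monotonicity in the postcondition, applied to both projections of `Q ∩ R`.

module _ {ℓ : Level} {A : Set ℓ} {S : Rel A ℓ} where

  ⟪⟫-weaken : ∀ {P Q R : Pred A ℓ} → Q ⊆ R → ⟪ P ⟫ S ⟪ Q ⟫ → ⟪ P ⟫ S ⟪ R ⟫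
  ⟪⟫-weaken Q⊆R h x px = map₂ (λ q z s → Q⊆R (q z s)) (h x px)

  -- Each postcondition constrains every outcome, so the two hold jointly at each. Existence of an
  -- outcome is the same claim in both triples; `h` supplies it.
  ⟪⟫-∩ : ∀ {P P′ Q R : Pred A ℓ} →
         ⟪ P ⟫ S ⟪ Q ⟫ → ⟪ P′ ⟫ S ⟪ R ⟫ → ⟪ P ∩ P′ ⟫ S ⟪ Q ∩ R ⟫
  ⟪⟫-∩ h h′ x (p , p′) =
    proj₁ (h x p) , λ z s → proj₂ (h x p) z s , proj₂ (h′ x p′) z s

  -- By weakening, `V` is itself a precondition for `R`, and `W` is the largest such.
  wp-mono : ∀ {Q R V W : Pred A ℓ} → IsWP S Q V → IsWP S R W → Q ⊆ R → V ⊆ W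
  wp-mono v w Q⊆R {x} = wp₂ w _ (⟪⟫-weaken Q⊆R (wp₁ v)) x

theorem5p3 : ∀ {ℓ : Level} (A : Set ℓ) (Q R : Pred A ℓ) (S : Rel A ℓ)
    (wpQ wpR wpQ∧R : Pred A ℓ) →
    IsWP S Q wpQ → IsWP S R wpR → IsWP S (Q ∩ R) wpQ∧R →
    ∀ x → (wpQ x × wpR x) ⇔ wpQ∧R x
theorem5p3 A Q R S wpQ wpR wpQ∧R isQ isR isQ∧R x = mk⇔
  (wp₂ isQ∧R (wpQ ∩ wpR) (⟪⟫-∩ (wp₁ isQ) (wp₁ isR)) x)
  < wp-mono isQ∧R isQ proj₁ , wp-mono isQ∧R isR proj₂ >
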